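{- Let $n$ be a positive integer, let $P_n$ be the boolean algebra of rank $n$, and let $\mathfrak{Z}_n = Z_{P_n} + Z_{P_n}^t$, where $Z_{P_n}$ is the zeta matrix of $P_n$. If $n \ge 3$ is odd, then $\det(\mathfrak{Z}_n) = 0$. If $n$ is even, then $\det(\mathfrak{Z}_n) = 2^{\alpha_n}$, where the integers $\alpha_n$ (for even $n\ge 2$) are defined recursively by $\alpha_2 = 2$ and $\alpha_n = 4\alpha_{n-2} - 2$ for even $n \ge 4$.
   Context: The boolean algebra $P_n$ of rank $n$ is the poset of all subsets of $[n]=\{1,2,\ldots,n\}$ ordered by inclusion; it has $2^n$ elements. For a finite poset $P$ with $N$ elements labelled $x_1,\ldots,x_N$ so that $x_i < x_j$ implies $i<j$, the zeta matrix $Z_P$ is the $N\times N$ matrix with $(Z_P)_{ij}=1$ if $x_i\le x_j$ and $(Z_P)_{ij}=0$ otherwise. The superscript $t$ denotes transpose. -}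

module Defs where

open import Algebra.Properties.CommutativeMonoid.Sum using (sum)
open import Data.Bool.Base using (if_then_else_)
import Data.Bool.Properties as Bool
open import Data.Fin.Base as Fin using (Fin; zero; suc; punchIn; toℕ)
open import Data.Fin.Subset using (Subset)
open import Data.Fin.Subset.Properties using (_⊆?_; ⊆-isPartialOrder)
open import Data.Integer.Base as ℤ using (ℤ; +_; 0ℤ; 1ℤ; -1ℤ)
import Data.Integer.Properties as ℤ
open import Data.Nat.Base as ℕ using (ℕ; zero; suc; z≤n; s≤s)
import Data.Nat.Properties as ℕ
open import Data.Vec.Functional using (Vector; zipWith; transpose)
open import Data.Vec.Properties using (≡-dec)
open import Function.Definitions using (Bijective)
open import Level using (0ℓ; _⊔_)
open import Relation.Binary.Bundles using (DecPoset)
import Relation.Binary.Properties.Poset as PosetProperties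
open import Relation.Binary.PropositionalEquality using (_≡_; sym; trans; cong)
open import Relation.Nullary.Decidable using (does)

Matrix : ℕ → ℕ → Set
Matrix m n = Vector (Vector ℤ n) m

infixl 6 _⊕_

_⊕_ : ∀ {m n} → Matrix m n → Matrix m n → Matrix m n
_⊕_ = zipWith (zipWith ℤ._+_)

-- Laplace expansion along the first row; punchIn j skips column j.
det : ∀ {n} → Matrix n n → ℤ
det {zero}  M = 1ℤ
det {suc n} M = sum ℤ.+-0-commutativeMonoid λ j →
  (-1ℤ ℤ.^ toℕ j) ℤ.* M zero j ℤ.* det (λ i k → M (suc i) (punchIn j k))

-- A labelling x₁, …, x_N of all the elements of P, without repetition, such
-- that xᵢ < xⱼ implies i < j.
record Labelling {c ℓ₁ ℓ₂} (P : DecPoset c ℓ₁ ℓ₂) (N : ℕ) : Set (c ⊔ ℓ₁ ⊔ ℓ₂) where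
  open DecPoset P using (Carrier; _≈_; poset)
  open PosetProperties poset using (_<_)
  field
    label     : Fin N → Carrier
    bijective : Bijective _≡_ _≈_ label
    linear    : ∀ i j → label i < label j → i Fin.< j

zeta : ∀ {c ℓ₁ ℓ₂} (P : DecPoset c ℓ₁ ℓ₂) {N} → Labelling P N → Matrix N N
zeta P L i j = if does (label i ≤? label j) then 1ℤ else 0ℤ
  where
  open DecPoset P using (_≤?_)
  open Labelling L using (label)

booleanAlgebra : ℕ → DecPoset 0ℓ 0ℓ 0ℓ
booleanAlgebra n = record
  { Carrier           = Subset n
  ; isDecPartialOrder = record
    { isPartialOrder = ⊆-isPartialOrder n
    ; _≟_            = ≡-dec Bool._≟_
    ; _≤?_           = _⊆?_
    }
  }

ℨ : ∀ n → Labelling (booleanAlgebra n) (2 ℕ.^ n) → Matrix (2 ℕ.^ n) (2 ℕ.^ n)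
ℨ n L = Z ⊕ transpose Z
  where Z = zeta (booleanAlgebra n) L

-- Only the values at even n ≥ 2 are meaningful; the others are junk.  The
-- subtraction is never truncated at those n, see α-recursion.
α : ℕ → ℕ
α 0                           = 0
α 1                           = 0
α 2                           = 2
α 3                           = 0
α (suc (suc n@(suc (suc _)))) = 4 ℕ.* α n ℕ.∸ 2

2≤α : ∀ k → 2 ℕ.≤ α (2 ℕ.+ k ℕ.* 2)
2≤4α : ∀ k → 2 ℕ.≤ 4 ℕ.* α (2 ℕ.+ k ℕ.* 2)

2≤α zero    = s≤s (s≤s z≤n)
2≤α (suc k) = ℕ.≤-trans (s≤s (s≤s z≤n)) (ℕ.∸-monoˡ-≤ 2 (ℕ.*-monoʳ-≤ 4 (2≤α k)))

2≤4α k = ℕ.≤-trans (2≤α k) (ℕ.m≤n*m _ 4)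

α-recursion : ∀ k → + α (4 ℕ.+ k ℕ.* 2) ≡ + 4 ℤ.* + α (2 ℕ.+ k ℕ.* 2) ℤ.- + 2
α-recursion k = trans (sym (ℤ.⊖-≥ (2≤4α k)))
  (trans (sym (ℤ.m-n≡m⊖n (4 ℕ.* a) 2)) (cong (ℤ._- + 2) (ℤ.pos-* 4 a)))
  where a = α (2 ℕ.+ k ℕ.* 2)

{-# OPTIONS --safe #-}
-- Ordered by inclusion, the zeta matrix of P_n is the n-th tensor power of the zeta matrix A
-- of the two-element chain.  Over the Eisenstein integers there are lower unitriangular P
-- and Q with P Aᵗ Q = I and P A Q = C, where C is upper triangular with the two primitive
-- sixth roots of unity u = - ζ² and ū = - ζ on its diagonal.  Tensor powers of P, Q, C are
-- triangular for every linear extension of inclusion, hence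
--   det (Z + Zᵗ) = det (C^⊗n + I) = ∏ over S ⊆ [n] of (1 + u^(n - |S|) ū^|S|).
-- Splitting off two elements of [n] relates the products ∏ (1 + a u^(n - |S|) ū^|S|)
-- for a = 1, ζ, ζ²: for odd n the one with a = ζ vanishes, and for even n the one
-- with a = 1 is 2^α while those with a = ζ, ζ² multiply to 2^(2(α - 1)).
module Submission where

open import Defs
open import Data.Integer.Base using (+_; 0ℤ)
open import Data.Nat.Base using (ℕ; _≤_; _^_; NonZero)
open import Data.Nat.Divisibility using (_∣_; _∤_)
open import Data.Product.Base using (_×_)
open import Relation.Binary.PropositionalEquality using (_≡_)

open import Algebra.Bundles using (CommutativeMonoid; CommutativeRing)
open import Data.Bool.Base using (Bool; if_then_else_)
open import Data.Fin.Base as Fin using (Fin; zero; suc; punchIn; toℕ; combine; remQuot; _↑ˡ_; _↑ʳ_)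
open import Data.Fin.Permutation using (Permutation)
import Data.Fin.Properties as Fin
open import Data.Fin.Subset using (Subset; inside; outside; _⊈_)
open import Data.Fin.Subset.Properties using (⊆-refl; out⊆; in⊆in; _⊆?_)
open import Data.Integer.Base as ℤ using (ℤ; 1ℤ; -1ℤ)
import Data.Integer.Properties as ℤ
import Data.Integer.Tactic.RingSolver as ℤ-Solver
open import Data.Nat.Base as ℕ using (zero; suc; s≤s; z<s; s<s)
open import Data.Nat.DivMod using (_/_; _%_; m≡m%n+[m/n]*n; m%n<n)
open import Data.Nat.Divisibility using (divides)
import Data.Nat.Properties as ℕ
import Data.Nat.Tactic.RingSolver as ℕ-Solver
open import Data.Product.Base using (_,_; proj₁; ∃-syntax)
open import Data.Unit.Polymorphic.Base using (⊤)
open import Data.Vec.Functional using (Vector)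
open import Function.Base using (_∘_; flip)
open import Function.Bundles using (mk↔ₛ′; mk⤖; module Inverse)
open import Function.Construct.Composition using (_↔-∘_)
open import Function.Properties.Bijection using (⤖⇒↔)
open import Level using (0ℓ; _⊔_)
open import Relation.Binary.PropositionalEquality as ≡ using (_≢_)
open import Relation.Nullary.Decidable using (does)
open import Relation.Nullary.Negation using (contradiction)
import Algebra.Properties.CommutativeMonoid.Sum ℤ.+-0-commutativeMonoid as ℤ-Sum

-- Determinants over a commutative ring

module Determinant {c ℓ} (R : CommutativeRing c ℓ) where
  open import Data.Vec.Functional using ([]; _∷_; head; tail; map; removeAt; transpose)
  open CommutativeRing R hiding (zero)
  open import Algebra.Properties.Ring ring using (-1*x≈-x; -0#≈0#; +-inverseʳ-unique)
  open import Algebra.Properties.Semiring.Exp semiring using () renaming (_^_ to _^ᴿ_)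
  open import Algebra.Properties.Semiring.Sum semiring
    using (sum; sum-cong-≋; sum-remove; ∑-distrib-+; *-distribˡ-sum; *-distribʳ-sum; sum-replicate-zero)
  open import Algebra.Properties.CommutativeMonoid.Sum *-commutativeMonoid
    using () renaming (sum to product; sum-cong-≋ to product-cong; sum-replicate-zero to product-replicate-one)
  open import Relation.Binary.Reasoning.Setoid setoid
  open import Algebra.Solver.Ring.NaturalCoefficients.Default commutativeSemiring
    using (solve; _:+_; _:*_; _:=_; con)

  private
    variable m n : ℕ

  Mat : ℕ → ℕ → Set c
  Mat n m = Vector (Vector Carrier m) n

  infix 4 _≋_

  _≋_ : Mat n m → Mat n m → Set ℓ
  M ≋ N = ∀ i j → M i j ≈ N i j

  -- sum-cong-≋ cannot infer the two summands once the number of terms is a successor.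
  ∑-cong : (s t : Vector Carrier n) → (∀ k → s k ≈ t k) → sum s ≈ sum t
  ∑-cong s t = sum-cong-≋

  ∑-zero : (t : Vector Carrier n) → (∀ k → t k ≈ 0#) → sum t ≈ 0#
  ∑-zero {n} t t≈0 = trans (∑-cong t (λ _ → 0#) t≈0) (sum-replicate-zero n)

  detᴿ : Mat n n → Carrier
  detᴿ {zero}  M = 1#
  detᴿ {suc n} M = sum λ j →
    (- 1#) ^ᴿ toℕ j * M zero j * detᴿ (λ i k → M (suc i) (punchIn j k))

  det-cong : {M N : Mat n n} → M ≋ N → detᴿ M ≈ detᴿ N
  det-cong {zero}  M≋N = refl
  det-cong {suc n} {M} {N} M≋N = ∑-cong (term M) (term N) λ j →
    *-cong (*-congˡ (M≋N zero j)) (det-cong λ i k → M≋N (suc i) (punchIn j k))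
    where
    term : Mat (suc n) (suc n) → Vector Carrier (suc n)
    term M j = (- 1#) ^ᴿ toℕ j * M zero j * detᴿ (λ i k → M (suc i) (punchIn j k))

  -- Alternating forms in the rows of a matrix

  Congruent : (Mat n m → Carrier) → Set (c ⊔ ℓ)
  Congruent f = ∀ {M N} → M ≋ N → f M ≈ f N

  HeadLinear : (Mat (suc n) m → Carrier) → Set (c ⊔ ℓ)
  HeadLinear f = ∀ u a v r → f ((λ k → u k + a * v k) ∷ r) ≈ f (u ∷ r) + a * f (v ∷ r)

  HeadAlternates : (Mat (suc n) m → Carrier) → Set (c ⊔ ℓ)
  HeadAlternates {zero}  f = ⊤
  HeadAlternates {suc n} f = ∀ v r → f (v ∷ v ∷ r) ≈ 0#

  -- Asking only for linearity in the first row and vanishing when the first two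
  -- rows agree, but for every form obtained by fixing some leading rows, makes
  -- every proof about alternating forms a plain induction on the number of rows.
  data Alternating {m} : (Mat n m → Carrier) → Set (c ⊔ ℓ) where
    nullary : {f : Mat zero m → Carrier} → Congruent f → Alternating f
    cons    : {f : Mat (suc n) m → Carrier} → Congruent f → HeadLinear f →
              HeadAlternates f → (∀ v → Alternating (λ r → f (v ∷ r))) → Alternating f

  private
    variable f g h : Mat n m → Carrier

  congruent : Alternating f → Congruent f
  congruent (nullary f-cong)    = f-cong
  congruent (cons f-cong _ _ _) = f-cong

  fixHead : Alternating f → ∀ v → Alternating (λ r → f (v ∷ r))
  fixHead (cons _ _ _ f-fix) = f-fix

  headLinear : Alternating f → HeadLinear f
  headLinear (cons _ f-linear _ _) = f-linear

  headAlternates : Alternating f → HeadAlternates f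
  headAlternates (cons _ _ f-alt _) = f-alt

  ∷-cong : {u v : Vector Carrier m} {r s : Mat n m} →
           (∀ k → u k ≈ v k) → r ≋ s → (u ∷ r) ≋ (v ∷ s)
  ∷-cong u≈v r≋s zero    = u≈v
  ∷-cong u≈v r≋s (suc i) = r≋s i

  head∷tail : (M : Mat (suc n) m) → M ≋ (head M ∷ tail M)
  head∷tail M zero    k = refl
  head∷tail M (suc i) k = refl

  map-tail-∷ : (v : Vector Carrier (suc m)) (r : Mat n (suc m)) →
               map tail (v ∷ r) ≋ (tail v ∷ map tail r)
  map-tail-∷ v r zero    k = refl
  map-tail-∷ v r (suc i) k = refl

  alternating-resp : (∀ r → f r ≈ g r) → Alternating f → Alternating g
  alternating-resp f≈g (nullary f-cong) = nullary λ r≋s →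
    trans (sym (f≈g _)) (trans (f-cong r≋s) (f≈g _))
  alternating-resp f≈g (cons {n = n} f-cong f-linear f-alt f-fix) = cons
    (λ r≋s → trans (sym (f≈g _)) (trans (f-cong r≋s) (f≈g _)))
    (λ u a v r → trans (sym (f≈g _)) (trans (f-linear u a v r) (+-cong (f≈g _) (*-congˡ (f≈g _)))))
    (alternates n f≈g f-alt)
    (λ v → alternating-resp (λ r → f≈g (v ∷ r)) (f-fix v))
    where
    alternates : ∀ n {f g : Mat (suc n) m → Carrier} → (∀ r → f r ≈ g r) →
                 HeadAlternates f → HeadAlternates g
    alternates zero    f≈g f-alt     = _
    alternates (suc n) f≈g f-alt v r = trans (sym (f≈g _)) (f-alt v r)

  alternating-combination : ∀ a b → Alternating f → Alternating g → Alternating (λ r → a * f r + b * g r)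
  alternating-combination a b (nullary f-cong) (nullary g-cong) = nullary λ r≋s →
    +-cong (*-congˡ (f-cong r≋s)) (*-congˡ (g-cong r≋s))
  alternating-combination {f = f} {g = g} a b
    (cons {n = n} f-cong f-linear f-alt f-fix) (cons g-cong g-linear g-alt g-fix) = cons
    (λ r≋s → +-cong (*-congˡ (f-cong r≋s)) (*-congˡ (g-cong r≋s)))
    (λ u c v r → trans (+-cong (*-congˡ (f-linear u c v r)) (*-congˡ (g-linear u c v r)))
                       (rearranged a b c (f (u ∷ r)) (f (v ∷ r)) (g (u ∷ r)) (g (v ∷ r))))
    (alternates n f-alt g-alt)
    (λ v → alternating-combination a b (f-fix v) (g-fix v))
    where
    rearranged : ∀ a b c x y z w → a * (x + c * y) + b * (z + c * w) ≈ (a * x + b * z) + c * (a * y + b * w)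
    rearranged = solve 7 (λ a b c x y z w → a :* (x :+ c :* y) :+ b :* (z :+ c :* w) := (a :* x :+ b :* z) :+ c :* (a :* y :+ b :* w)) refl

    alternates : ∀ n {f g : Mat (suc n) m → Carrier} → HeadAlternates f → HeadAlternates g →
                 HeadAlternates (λ r → a * f r + b * g r)
    alternates zero    f-alt g-alt     = _
    alternates (suc n) f-alt g-alt v r = begin
      _                ≈⟨ +-cong (*-congˡ (f-alt v r)) (*-congˡ (g-alt v r)) ⟩
      a * 0# + b * 0#  ≈⟨ +-cong (zeroʳ a) (zeroʳ b) ⟩
      0# + 0#          ≈⟨ +-identityˡ 0# ⟩
      0#               ∎

  alternating-tail : {f : Mat n m → Carrier} → Alternating f → Alternating (λ r → f (map tail r))
  alternating-tail (nullary f-cong) = nullary λ r≋s → f-cong (λ i k → r≋s i (suc k))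
  alternating-tail (cons {n = n} f-cong f-linear f-alt f-fix) = cons
    (λ r≋s → f-cong λ i k → r≋s i (suc k))
    (λ u a v r → trans (f-cong (map-tail-∷ _ r)) (trans (f-linear (tail u) a (tail v) (map tail r))
      (+-cong (f-cong (λ i k → sym (map-tail-∷ u r i k)))
              (*-congˡ (f-cong (λ i k → sym (map-tail-∷ v r i k)))))))
    (alternates n f-cong f-alt)
    (λ v → alternating-resp (λ r → f-cong (λ i k → sym (map-tail-∷ v r i k)))
                            (alternating-tail (f-fix (tail v))))
    where
    alternates : ∀ n {f : Mat (suc n) m → Carrier} → Congruent f → HeadAlternates f →
                 HeadAlternates (λ r → f (map tail r))
    alternates zero    f-cong f-alt     = _
    alternates (suc n) f-cong f-alt v r = trans
      (f-cong λ { zero k → refl ; (suc zero) k → refl ; (suc (suc i)) k → refl })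
      (f-alt (tail v) (map tail r))

  -- Laplace expansion along the first column

  expandTerm : (Mat n m → Carrier) → Mat (suc n) (suc m) → Vector Carrier (suc n)
  expandTerm g r k = (- 1#) ^ᴿ toℕ k * r k zero * g (λ i → tail (r (punchIn k i)))

  expand : (Mat n m → Carrier) → Mat (suc n) (suc m) → Carrier
  expand g r = sum (expandTerm g r)

  expand-cong : (∀ r → g r ≈ h r) → ∀ r → expand g r ≈ expand h r
  expand-cong {g = g} {h = h} g≈h r = ∑-cong (expandTerm g r) (expandTerm h r) λ k → *-congˡ (g≈h _)

  expand-congruent : Congruent g → Congruent (expand g)
  expand-congruent {g = g} g-cong {r} {s} r≋s = ∑-cong (expandTerm g r) (expandTerm g s) λ k →
    *-cong (*-congˡ (r≋s k zero)) (g-cong λ i l → r≋s (punchIn k i) (suc l))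

  expand-linear : (g h : Mat n m → Carrier) → ∀ a r →
                  expand (λ s → g s + a * h s) r ≈ expand g r + a * expand h r
  expand-linear g h a r = begin
    expand (λ s → g s + a * h s) r
      ≈⟨ ∑-cong (expandTerm (λ s → g s + a * h s) r) (λ k → expandTerm g r k + a * expandTerm h r k)
                (λ k → rearranged ((- 1#) ^ᴿ toℕ k * r k zero) a _ _) ⟩
    sum (λ k → expandTerm g r k + a * expandTerm h r k)
      ≈⟨ ∑-distrib-+ (expandTerm g r) (λ k → a * expandTerm h r k) ⟩
    expand g r + sum (λ k → a * expandTerm h r k)
      ≈⟨ +-congˡ (*-distribˡ-sum a (expandTerm h r)) ⟨
    expand g r + a * expand h r ∎
    where
    rearranged : ∀ t a x y → t * (x + a * y) ≈ t * x + a * (t * y)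
    rearranged = solve 4 (λ t a x y → t :* (x :+ a :* y) := t :* x :+ a :* (t :* y)) refl

  -- Fixing the first row of a Laplace expansion along the first column leaves a
  -- combination of a form on the tails and a smaller expansion of the same kind.
  expand-∷ : Congruent g → ∀ v r →
             expand g (v ∷ r) ≈ v zero * g (map tail r) + - 1# * expand (λ s → g (tail v ∷ s)) r
  expand-∷ {g = g} g-cong v r = +-cong
    (*-congʳ (*-identityˡ (v zero)))
    (begin
      sum (λ k → (- 1#) ^ᴿ suc (toℕ k) * r k zero * g (λ i → tail ((v ∷ r) (punchIn (suc k) i))))
        ≈⟨ sum-cong-≋ (λ k → trans (*-congˡ (g-cong (minor k))) (rearranged (- 1#) ((- 1#) ^ᴿ toℕ k) (r k zero) _)) ⟩
      sum (λ k → - 1# * term k)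
        ≈⟨ *-distribˡ-sum (- 1#) term ⟨
      - 1# * sum term ∎)
    where
    term : Fin _ → Carrier
    term k = (- 1#) ^ᴿ toℕ k * r k zero * g (tail v ∷ (λ i → tail (r (punchIn k i))))

    minor : ∀ k → (λ i → tail ((v ∷ r) (punchIn (suc k) i))) ≋ (tail v ∷ (λ i → tail (r (punchIn k i))))
    minor k zero    l = refl
    minor k (suc i) l = refl

    rearranged : ∀ s t x y → s * t * x * y ≈ s * (t * x * y)
    rearranged = solve 4 (λ s t x y → s :* t :* x :* y := s :* (t :* x :* y)) refl

  -- Only the term that deletes the leading `v` survives, since in every other term `g` sees
  -- `tail v` twice. The surviving value cancels the first summand of `expand-∷` when the two
  -- leading rows agree.
  expand-repeated : ∀ n {g : Mat (suc n) m → Carrier} → Congruent g → HeadAlternates g →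
    ∀ v r → expand (λ s → g (tail v ∷ s)) (v ∷ r) ≈ v zero * g (tail v ∷ map tail r)
  expand-repeated zero g-cong _ v r = trans (+-identityʳ _)
    (*-cong (*-identityˡ (v zero)) (g-cong (∷-cong (λ _ → refl) λ ())))
  expand-repeated (suc n) {g} g-cong g-alt v r = begin
    expand (λ s → g (tail v ∷ s)) (v ∷ r)
      ≈⟨ expand-∷ (λ r≋s → g-cong (∷-cong (λ _ → refl) r≋s)) v r ⟩
    v zero * g (tail v ∷ map tail r) + - 1# * expand (λ s → g (tail v ∷ tail v ∷ s)) r
      ≈⟨ +-congˡ (*-congˡ (∑-zero (expandTerm (λ s → g (tail v ∷ tail v ∷ s)) r) λ k → trans (*-congˡ (g-alt (tail v) _)) (zeroʳ _))) ⟩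
    v zero * g (tail v ∷ map tail r) + - 1# * 0#
      ≈⟨ +-congˡ (zeroʳ _) ⟩
    v zero * g (tail v ∷ map tail r) + 0#
      ≈⟨ +-identityʳ _ ⟩
    v zero * g (tail v ∷ map tail r) ∎

  -- Induction on the rows of `g`. By `expand-∷`, fixing the first row leaves a combination of `g`
  -- on the tails and an expansion of a form with one row fewer, both already alternating.
  alternating-expand : {g : Mat n m → Carrier} → Alternating g → Alternating (expand g)
  alternating-expand {g = g} (nullary g-cong) = cons
    (expand-congruent g-cong)
    (λ u a v r → trans
      (+-congʳ (*-congˡ (g-cong λ ())))
      (trans (rearranged (u zero) a (v zero) (g []))
             (+-cong (+-congʳ (*-congˡ (g-cong λ ())))
                     (*-congˡ (+-congʳ (*-congˡ (g-cong λ ())))))))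
    _
    (λ v → nullary λ r≋s → expand-congruent g-cong (∷-cong {u = v} {v} (λ _ → refl) r≋s))
    where
    rearranged : ∀ x a y z → 1# * (x + a * y) * z + 0# ≈ (1# * x * z + 0#) + a * (1# * y * z + 0#)
    rearranged = solve 4 (λ x a y z → con 1 :* (x :+ a :* y) :* z :+ con 0 := (con 1 :* x :* z :+ con 0) :+ a :* (con 1 :* y :* z :+ con 0)) refl
  alternating-expand {g = g} g-alt@(cons g-cong g-linear g-alt₂ g-fix) = cons
    (expand-congruent g-cong)
    (λ u a v r → begin
      expand g ((λ k → u k + a * v k) ∷ r)
        ≈⟨ expand-∷ g-cong _ r ⟩
      (u zero + a * v zero) * g (map tail r) + - 1# * expand (λ s → g ((λ k → u (suc k) + a * v (suc k)) ∷ s)) r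
        ≈⟨ +-congˡ (*-congˡ (trans
          (expand-cong {g = λ s → g ((λ k → u (suc k) + a * v (suc k)) ∷ s)}
                       {h = λ s → g (tail u ∷ s) + a * g (tail v ∷ s)}
                       (g-linear (tail u) a (tail v)) r)
          (expand-linear (λ s → g (tail u ∷ s)) (λ s → g (tail v ∷ s)) a r))) ⟩
      (u zero + a * v zero) * g (map tail r)
        + - 1# * (expand (λ s → g (tail u ∷ s)) r + a * expand (λ s → g (tail v ∷ s)) r)
        ≈⟨ rearranged (- 1#) (u zero) a (v zero) (g (map tail r)) _ _ ⟩
      (u zero * g (map tail r) + - 1# * expand (λ s → g (tail u ∷ s)) r)
        + a * (v zero * g (map tail r) + - 1# * expand (λ s → g (tail v ∷ s)) r)
        ≈⟨ +-cong (expand-∷ g-cong u r) (*-congˡ (expand-∷ g-cong v r)) ⟨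
      expand g (u ∷ r) + a * expand g (v ∷ r) ∎)
    (λ v r → begin
      expand g (v ∷ v ∷ r)
        ≈⟨ expand-∷ g-cong v (v ∷ r) ⟩
      v zero * g (map tail (v ∷ r)) + - 1# * expand (λ s → g (tail v ∷ s)) (v ∷ r)
        ≈⟨ +-cong (*-congˡ (g-cong (map-tail-∷ v r))) (trans (*-congˡ (expand-repeated _ g-cong g-alt₂ v r)) (-1*x≈-x _)) ⟩
      v zero * g (tail v ∷ map tail r) - v zero * g (tail v ∷ map tail r)
        ≈⟨ -‿inverseʳ _ ⟩
      0# ∎)
    (λ v → alternating-resp (λ r → sym (expand-∷ g-cong v r))
      (alternating-combination (v zero) (- 1#) (alternating-tail g-alt) (alternating-expand (g-fix (tail v)))))
    where
    rearranged : ∀ s x a y z p q → (x + a * y) * z + s * (p + a * q) ≈ (x * z + s * p) + a * (y * z + s * q)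
    rearranged = solve 7 (λ s x a y z p q → (x :+ a :* y) :* z :+ s :* (p :+ a :* q) := (x :* z :+ s :* p) :+ a :* (y :* z :+ s :* q)) refl

  -- The first-row expansion of a transpose is by definition `expand` of the determinant of a
  -- smaller transpose. Starting from the transpose turns expansion along a row into expansion along
  -- a column, in which all rows of the argument have the same role.
  alternating-detᵀ : ∀ n → Alternating {n} {n} (λ M → detᴿ (transpose M))
  alternating-detᵀ zero    = nullary λ _ → refl
  alternating-detᵀ (suc n) = alternating-expand (alternating-detᵀ n)

  -- Row operations on an alternating form

  -- `HeadLinear` has no separate scaling clause, so the zero row is written as `v + (- 1#) * v`,
  -- which linearity sends to `f (v ∷ r) - f (v ∷ r)`.
  head-zero : Alternating f → ∀ {v} → (∀ k → v k ≈ 0#) → ∀ r → f (v ∷ r) ≈ 0#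
  head-zero {f = f} f-alt {v} v≈0 r = begin
    f (v ∷ r)
      ≈⟨ congruent f-alt (∷-cong (λ k → trans (v≈0 k) (sym (trans (+-cong (v≈0 k) (trans (*-congˡ (v≈0 k)) (zeroʳ _))) (+-identityˡ 0#)))) λ _ _ → refl) ⟩
    f ((λ k → v k + - 1# * v k) ∷ r)
      ≈⟨ headLinear f-alt v (- 1#) v r ⟩
    f (v ∷ r) + - 1# * f (v ∷ r)
      ≈⟨ +-congˡ (-1*x≈-x _) ⟩
    f (v ∷ r) - f (v ∷ r)
      ≈⟨ -‿inverseʳ _ ⟩
    0# ∎

  head-sum : {f : Mat (suc n) m → Carrier} → Alternating f → ∀ {k} (a : Vector Carrier k) (M : Mat k m) r →
             f ((λ l → sum λ j → a j * M j l) ∷ r) ≈ sum λ j → a j * f (M j ∷ r)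
  head-sum f-alt {zero}  a M r = head-zero f-alt (λ _ → refl) r
  head-sum {f = f} f-alt {suc k} a M r = begin
    f ((λ l → a zero * M zero l + sum (λ j → a (suc j) * M (suc j) l)) ∷ r)
      ≈⟨ congruent f-alt (∷-cong (λ l → +-comm _ _) λ _ _ → refl) ⟩
    f ((λ l → sum (λ j → a (suc j) * M (suc j) l) + a zero * M zero l) ∷ r)
      ≈⟨ headLinear f-alt _ (a zero) (M zero) r ⟩
    f ((λ l → sum (λ j → a (suc j) * M (suc j) l)) ∷ r) + a zero * f (M zero ∷ r)
      ≈⟨ +-congʳ (head-sum f-alt (tail a) (tail M) r) ⟩
    sum (λ j → a (suc j) * f (M (suc j) ∷ r)) + a zero * f (M zero ∷ r)
      ≈⟨ +-comm _ _ ⟩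
    sum (λ j → a j * f (M j ∷ r)) ∎

  -- Polarisation: `f` vanishes on the repeated row `w = u + v`, and expanding both copies of `w`
  -- leaves only the two mixed terms.
  swap : {f : Mat (suc (suc n)) m → Carrier} → Alternating f → ∀ u v r → f (u ∷ v ∷ r) ≈ - f (v ∷ u ∷ r)
  swap {f = f} f-alt u v r = +-inverseʳ-unique _ _ (begin
    f (v ∷ u ∷ r) + f (u ∷ v ∷ r)
      ≈⟨ rearranged _ _ ⟩
    (0# + 1# * f (u ∷ v ∷ r)) + 1# * (f (v ∷ u ∷ r) + 1# * 0#)
      ≈⟨ +-cong (+-congʳ (headAlternates f-alt u r))
                (*-congˡ (+-congˡ (*-congˡ (headAlternates f-alt v r)))) ⟨
    (f (u ∷ u ∷ r) + 1# * f (u ∷ v ∷ r)) + 1# * (f (v ∷ u ∷ r) + 1# * f (v ∷ v ∷ r))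
      ≈⟨ +-cong (headLinear (fixHead f-alt u) u 1# v r)
                (*-congˡ (headLinear (fixHead f-alt v) u 1# v r)) ⟨
    f (u ∷ w ∷ r) + 1# * f (v ∷ w ∷ r)
      ≈⟨ headLinear f-alt u 1# v (w ∷ r) ⟨
    f (w ∷ w ∷ r)
      ≈⟨ headAlternates f-alt w r ⟩
    0# ∎)
    where
    w : Vector Carrier _
    w k = u k + 1# * v k

    rearranged : ∀ x y → y + x ≈ (0# + 1# * x) + 1# * (y + 1# * 0#)
    rearranged = solve 2 (λ x y → y :+ x := (con 0 :+ con 1 :* x) :+ con 1 :* (y :+ con 1 :* con 0)) refl

  -- Swaps carry `v` down until it stands next to its copy.
  repeatedRow : {f : Mat (suc n) m → Carrier} → Alternating f → ∀ v r i → (∀ k → r i k ≈ v k) → f (v ∷ r) ≈ 0#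
  repeatedRow {f = f} f-alt v r zero r₀≈v = begin
    f (v ∷ r)            ≈⟨ congruent f-alt (λ { zero k → refl ; (suc zero) k → r₀≈v k ; (suc (suc i)) k → refl }) ⟩
    f (v ∷ v ∷ tail r)   ≈⟨ headAlternates f-alt v (tail r) ⟩
    0#                   ∎
  repeatedRow {n = suc n} {f = f} f-alt v r (suc i) rᵢ≈v = begin
    f (v ∷ r)                   ≈⟨ congruent f-alt (∷-cong (λ _ → refl) (head∷tail r)) ⟩
    f (v ∷ head r ∷ tail r)     ≈⟨ swap f-alt v (head r) (tail r) ⟩
    - f (head r ∷ v ∷ tail r)   ≈⟨ -‿cong (repeatedRow (fixHead f-alt (head r)) v (tail r) i rᵢ≈v) ⟩
    - 0#                        ≈⟨ -0#≈0# ⟩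
    0#                          ∎

  -- Row `j` reaches the top by `j` adjacent swaps; this is where the signs of the Laplace expansion
  -- come from.
  cycle : {f : Mat (suc n) m → Carrier} → Alternating f → ∀ M j → f (M j ∷ removeAt M j) ≈ (- 1#) ^ᴿ toℕ j * f M
  cycle {f = f} f-alt M zero = trans (congruent f-alt (λ i k → sym (head∷tail M i k))) (sym (*-identityˡ (f M)))
  cycle {n = suc n} {f = f} f-alt M (suc j) = begin
    f (M (suc j) ∷ removeAt M (suc j))
      ≈⟨ congruent f-alt (∷-cong (λ _ → refl) (head∷tail (removeAt M (suc j)))) ⟩
    f (M (suc j) ∷ head M ∷ removeAt (tail M) j)
      ≈⟨ swap f-alt _ _ _ ⟩
    - f (head M ∷ tail M j ∷ removeAt (tail M) j)
      ≈⟨ -‿cong (cycle (fixHead f-alt (head M)) (tail M) j) ⟩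
    - ((- 1#) ^ᴿ toℕ j * f (head M ∷ tail M))
      ≈⟨ -‿cong (*-congˡ (congruent f-alt (head∷tail M))) ⟨
    - ((- 1#) ^ᴿ toℕ j * f M)
      ≈⟨ -1*x≈-x _ ⟨
    - 1# * ((- 1#) ^ᴿ toℕ j * f M)
      ≈⟨ *-assoc _ _ _ ⟨
    (- 1#) ^ᴿ suc (toℕ j) * f M ∎

  -- The hypothesis `kills` holds for a form in which `v` is already fixed as an earlier row. The
  -- multiples of `v` are stripped off one row at a time.
  cancelRow : {f : Mat n m → Carrier} → Alternating f → (v : Vector Carrier m) →
              (∀ (r : Mat n m) i → (∀ k → r i k ≈ v k) → f r ≈ 0#) →
              (r : Mat n m) (a : Vector Carrier n) → f (λ i k → r i k + a i * v k) ≈ f r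
  cancelRow {n = zero}  f-alt v kills r a = congruent f-alt λ ()
  cancelRow {n = suc n} {f = f} f-alt v kills r a = begin
    f (λ i k → r i k + a i * v k)
      ≈⟨ congruent f-alt (head∷tail _) ⟩
    f ((λ k → head r k + head a * v k) ∷ rest)
      ≈⟨ headLinear f-alt (head r) (head a) v rest ⟩
    f (head r ∷ rest) + head a * f (v ∷ rest)
      ≈⟨ +-congˡ (trans (*-congˡ (kills (v ∷ rest) zero λ _ → refl)) (zeroʳ (head a))) ⟩
    f (head r ∷ rest) + 0#
      ≈⟨ +-identityʳ _ ⟩
    f (head r ∷ rest)
      ≈⟨ cancelRow (fixHead f-alt (head r)) v (λ s i → kills (head r ∷ s) (suc i)) (tail r) (tail a) ⟩
    f (head r ∷ tail r)
      ≈⟨ congruent f-alt (head∷tail r) ⟨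
    f r ∎
    where
    rest : Mat n _
    rest i k = tail r i k + tail a i * v k

  -- Matrix products, transposes and triangular matrices

  infixl 7 _⊡_

  _⊡_ : ∀ {k} → Mat n m → Mat m k → Mat n k
  (A ⊡ B) i k = sum λ j → A i j * B j k

  -- Uniqueness of the determinant up to scale: expanding the first row of the product over the rows
  -- of `M` gives one term per `j`, and these terms form the Laplace expansion of `detᴿ A`. The row
  -- length `m` is independent of `n` because the recursion fixes rows without shortening the
  -- others.
  alternating-⊡ : {f : Mat n m → Carrier} → Alternating f → ∀ (A : Mat n n) M → f (A ⊡ M) ≈ detᴿ A * f M
  alternating-⊡ {n = zero} f-alt A M = trans (congruent f-alt λ ()) (sym (*-identityˡ _))
  alternating-⊡ {n = suc n} {f = f} f-alt A M = begin
    f (A ⊡ M)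
      ≈⟨ congruent f-alt (head∷tail _) ⟩
    f ((λ k → sum λ j → A zero j * M j k) ∷ tail (A ⊡ M))
      ≈⟨ head-sum f-alt (A zero) M _ ⟩
    sum (λ j → A zero j * f (M j ∷ tail (A ⊡ M)))
      ≈⟨ ∑-cong (λ j → A zero j * f (M j ∷ tail (A ⊡ M))) (λ j → term j * f M)
                (λ j → trans (*-congˡ (cofactor j)) (rearranged (A zero j) (detᴿ (minor j)) _ (f M))) ⟩
    sum (λ j → term j * f M)
      ≈⟨ *-distribʳ-sum (f M) term ⟨
    detᴿ A * f M ∎
    where
    minor : Fin (suc n) → Mat n n
    minor j i k = A (suc i) (punchIn j k)

    term : Vector Carrier (suc n)
    term j = (- 1#) ^ᴿ toℕ j * A zero j * detᴿ (minor j)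

    -- Row j of M already stands first, so its multiples in the other rows do not matter.
    cofactor : ∀ j → f (M j ∷ tail (A ⊡ M)) ≈ detᴿ (minor j) * ((- 1#) ^ᴿ toℕ j * f M)
    cofactor j = begin
      f (M j ∷ tail (A ⊡ M))
        ≈⟨ congruent f-alt (∷-cong (λ _ → refl) λ i k → trans (sum-remove {i = j} (λ l → A (suc i) l * M l k)) (+-comm _ _)) ⟩
      f (M j ∷ (λ i k → (minor j ⊡ removeAt M j) i k + A (suc i) j * M j k))
        ≈⟨ cancelRow (fixHead f-alt (M j)) (M j) (repeatedRow f-alt (M j)) (minor j ⊡ removeAt M j) (λ i → A (suc i) j) ⟩
      f (M j ∷ minor j ⊡ removeAt M j)
        ≈⟨ alternating-⊡ (fixHead f-alt (M j)) (minor j) (removeAt M j) ⟩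
      detᴿ (minor j) * f (M j ∷ removeAt M j)
        ≈⟨ *-congˡ (cycle f-alt M j) ⟩
      detᴿ (minor j) * ((- 1#) ^ᴿ toℕ j * f M) ∎

    rearranged : ∀ a d s x → a * (d * (s * x)) ≈ s * a * d * x
    rearranged = solve 4 (λ a d s x → a :* (d :* (s :* x)) := s :* a :* d :* x) refl

  identity : Mat n n
  identity zero    zero    = 1#
  identity zero    (suc j) = 0#
  identity (suc i) zero    = 0#
  identity (suc i) (suc j) = identity i j

  identity-sym : (i j : Fin n) → identity i j ≈ identity j i
  identity-sym zero    zero    = refl
  identity-sym zero    (suc j) = refl
  identity-sym (suc i) zero    = refl
  identity-sym (suc i) (suc j) = identity-sym i j

  identity-offDiagonal : (i j : Fin n) → i Fin.< j → identity i j ≈ 0#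
  identity-offDiagonal zero    (suc j) _         = refl
  identity-offDiagonal (suc i) (suc j) (s<s i<j) = identity-offDiagonal i j i<j

  identity-diagonal : (i : Fin n) → identity i i ≈ 1#
  identity-diagonal zero    = refl
  identity-diagonal (suc i) = identity-diagonal i

  ⊡-identityʳ : (A : Mat n m) → A ⊡ identity ≋ A
  ⊡-identityʳ A i = select (A i)
    where
    select : (a : Vector Carrier n) → ∀ k → sum (λ j → a j * identity j k) ≈ a k
    select a zero    = trans
      (+-cong (*-identityʳ (a zero)) (∑-zero (λ j → a (suc j) * 0#) λ j → zeroʳ _))
      (+-identityʳ _)
    select a (suc k) = trans (+-cong (zeroʳ (a zero)) (select (tail a) k)) (+-identityˡ _)

  det-lowerTriangular : (A : Mat n n) → (∀ i j → i Fin.< j → A i j ≈ 0#) → detᴿ A ≈ product (λ i → A i i)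
  det-lowerTriangular {zero}  A lower = refl
  det-lowerTriangular {suc n} A lower = trans
    (+-cong
      (*-cong (*-identityˡ (A zero zero))
              (det-lowerTriangular (λ i j → A (suc i) (suc j)) λ i j i<j → lower (suc i) (suc j) (s<s i<j)))
      (∑-zero (λ j → term (suc j)) λ j →
        trans (*-congʳ (trans (*-congˡ (lower zero (suc j) z<s)) (zeroʳ _))) (zeroˡ _)))
    (+-identityʳ _)
    where
    term : Vector Carrier (suc n)
    term j = (- 1#) ^ᴿ toℕ j * A zero j * detᴿ (λ i k → A (suc i) (punchIn j k))

  det-identity : ∀ n → detᴿ (identity {n}) ≈ 1#
  det-identity n = trans (det-lowerTriangular {n} identity identity-offDiagonal)
    (trans (product-cong {n} identity-diagonal) (product-replicate-one n))

  -- This is `alternating-⊡` at the identity matrix, for the form already known to be alternating,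
  -- the determinant of the transpose.
  det-transpose : (A : Mat n n) → detᴿ (transpose A) ≈ detᴿ A
  det-transpose {n} A = begin
    detᴿ (transpose A)
      ≈⟨ det-cong (λ i j → ⊡-identityʳ A j i) ⟨
    detᴿ (transpose (A ⊡ identity))
      ≈⟨ alternating-⊡ (alternating-detᵀ n) A identity ⟩
    detᴿ A * detᴿ (transpose (identity {n}))
      ≈⟨ *-congˡ (trans (det-cong {n} (λ i j → identity-sym j i)) (det-identity n)) ⟩
    detᴿ A * 1#
      ≈⟨ *-identityʳ (detᴿ A) ⟩
    detᴿ A ∎

  det-⊡ : (A B : Mat n n) → detᴿ (A ⊡ B) ≈ detᴿ A * detᴿ B
  det-⊡ {n} A B = begin
    detᴿ (A ⊡ B)                 ≈⟨ det-transpose (A ⊡ B) ⟨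
    detᴿ (transpose (A ⊡ B))     ≈⟨ alternating-⊡ (alternating-detᵀ n) A B ⟩
    detᴿ A * detᴿ (transpose B)  ≈⟨ *-congˡ (det-transpose B) ⟩
    detᴿ A * detᴿ B              ∎

  det-upperTriangular : (A : Mat n n) → (∀ i j → j Fin.< i → A i j ≈ 0#) → detᴿ A ≈ product (λ i → A i i)
  det-upperTriangular A upper = trans (sym (det-transpose A))
    (det-lowerTriangular (transpose A) λ i j i<j → upper j i i<j)

-- Folds over all subsets

open import Data.Vec.Base using ([]; _∷_)
open Inverse Fin.2↔Bool using () renaming (to to unbit; from to bit; strictlyInverseˡ to unbit-bit; strictlyInverseʳ to bit-unbit)

-- Membership bits read as binary digits. This enumeration need not agree with a given labelling; it
-- serves to compare sums over `Fin (2 ^ n)` with folds over subsets.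
encode : ∀ {n} → Subset n → Fin (2 ℕ.^ n)
encode []      = zero
encode (b ∷ S) = combine (bit b) (encode S)

decode : ∀ n → Fin (2 ℕ.^ n) → Subset n
decode zero    i = []
decode (suc n) i = let b , j = remQuot (2 ℕ.^ n) i in unbit b ∷ decode n j

decode-encode : ∀ {n} (S : Subset n) → decode n (encode S) ≡ S
decode-encode []      = ≡.refl
decode-encode {suc n} (b ∷ S) = ≡.trans
  (≡.cong (λ (c , j) → unbit c ∷ decode n j) (Fin.remQuot-combine (bit b) (encode S)))
  (≡.cong₂ _∷_ (unbit-bit b) (decode-encode S))

encode-decode : ∀ n i → encode (decode n i) ≡ i
encode-decode zero    zero = ≡.refl
encode-decode (suc n) i    = let c , j = remQuot {2} (2 ℕ.^ n) i in ≡.trans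
  (≡.cong₂ combine (bit-unbit c) (encode-decode n j))
  (Fin.combine-remQuot {2} (2 ℕ.^ n) i)

module SubsetFold {c ℓ} (M : CommutativeMonoid c ℓ) where
  open CommutativeMonoid M
  open import Algebra.Properties.CommutativeMonoid.Sum M using (sum; sum-cong-≗; sum-permute)
  open import Algebra.Properties.CommutativeSemigroup commutativeSemigroup using (interchange)

  foldSubsets : ∀ n → (Subset n → Carrier) → Carrier
  foldSubsets zero    f = f []
  foldSubsets (suc n) f = foldSubsets n (f ∘ (outside ∷_)) ∙ foldSubsets n (f ∘ (inside ∷_))

  foldSubsets-cong : ∀ n {f g : Subset n → Carrier} → (∀ S → f S ≈ g S) → foldSubsets n f ≈ foldSubsets n g
  foldSubsets-cong zero    f≈g = f≈g []
  foldSubsets-cong (suc n) f≈g =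
    ∙-cong (foldSubsets-cong n (f≈g ∘ (outside ∷_))) (foldSubsets-cong n (f≈g ∘ (inside ∷_)))

  foldSubsets-∙ : ∀ n (f g : Subset n → Carrier) →
                  foldSubsets n (λ S → f S ∙ g S) ≈ foldSubsets n f ∙ foldSubsets n g
  foldSubsets-∙ zero    f g = refl
  foldSubsets-∙ (suc n) f g = trans (∙-cong (foldSubsets-∙ n _ _) (foldSubsets-∙ n _ _)) (interchange _ _ _ _)

  sum-split : ∀ m {n} (f : Vector Carrier (m ℕ.+ n)) → sum f ≈ sum (f ∘ (_↑ˡ n)) ∙ sum (f ∘ (m ↑ʳ_))
  sum-split zero    f = sym (identityˡ _)
  sum-split (suc m) f = trans (∙-congˡ (sum-split m (f ∘ suc))) (sym (assoc _ _ _))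

  sum-encode : ∀ n (f : Vector Carrier (2 ℕ.^ n)) → sum f ≈ foldSubsets n (f ∘ encode)
  sum-encode zero    f = identityʳ _
  sum-encode (suc n) f = trans (sum-split (2 ℕ.^ n) f) (∙-cong
    (sum-encode n _)
    -- `2 ^ suc n` unfolds to `2 ^ n + (2 ^ n + 0)`, so the second split leaves an empty sum.
    (trans (sum-split (2 ℕ.^ n) _) (trans (identityʳ _) (sum-encode n _))))

  -- A labelling followed by `encode` permutes the indices, so the total does not depend on the
  -- labelling. Stated for any commutative monoid, this covers both the sums in matrix products and
  -- the products along diagonals.
  sum-label : ∀ n (L : Labelling (booleanAlgebra n) (2 ℕ.^ n)) (f : Subset n → Carrier) →
              sum (f ∘ Labelling.label L) ≈ foldSubsets n f
  sum-label n L f = begin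
    sum (f ∘ label)
      ≡⟨ sum-cong-≗ (λ i → ≡.cong f (≡.sym (decode-encode (label i)))) ⟩
    sum (f ∘ decode n ∘ encode ∘ label)
      ≈⟨ sum-permute (f ∘ decode n) relabelling ⟨
    sum (f ∘ decode n)
      ≈⟨ sum-encode n (f ∘ decode n) ⟩
    foldSubsets n (f ∘ decode n ∘ encode)
      ≈⟨ foldSubsets-cong n (λ S → reflexive (≡.cong f (decode-encode S))) ⟩
    foldSubsets n f ∎
    where
    open Labelling L
    open import Relation.Binary.Reasoning.Setoid setoid

    relabelling : Permutation (2 ℕ.^ n) (2 ℕ.^ n)
    relabelling = mk↔ₛ′ encode (decode n) (encode-decode n) decode-encode ↔-∘ ⤖⇒↔ (mk⤖ bijective)

module _ {n} (L : Labelling (booleanAlgebra n) (2 ℕ.^ n)) where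
  open Labelling L

  -- By injectivity the inclusion `label j ⊆ label i` would be strict, and `linear` would then put
  -- `j` before `i`.
  label-linear : ∀ {i j} → i Fin.< j → label j ⊈ label i
  label-linear {i} {j} i<j Lj⊆Li = Fin.<-asym i<j (linear j i (Lj⊆Li , distinct))
    where
    distinct : label j ≢ label i
    distinct eq = Fin.<-irrefl (≡.sym (proj₁ bijective eq)) i<j

-- Tensor powers of 2 × 2 matrices

module TensorPower {c ℓ} (R : CommutativeRing c ℓ) where
  open CommutativeRing R hiding (zero)
  open Determinant R
  open SubsetFold +-commutativeMonoid public using (sum-label)
    renaming (foldSubsets to ∑ˢ; foldSubsets-cong to ∑ˢ-cong; foldSubsets-∙ to ∑ˢ-+)
  open SubsetFold *-commutativeMonoid public using ()
    renaming (foldSubsets to ∏ˢ; foldSubsets-cong to ∏ˢ-cong; sum-label to product-label)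
  open import Algebra.Solver.Ring.NaturalCoefficients.Default commutativeSemiring
    using (solve; _:+_; _:*_; _:=_)
  open import Relation.Binary.Reasoning.Setoid setoid

  Mat₂ : Set c
  Mat₂ = Bool → Bool → Carrier

  infixl 7 _·_

  _·_ : Mat₂ → Mat₂ → Mat₂
  (X · Y) s t = X s outside * Y outside t + X s inside * Y inside t

  infix 8 _^⊗

  -- The Kronecker power, with rows and columns named by subsets so that no order on them is chosen
  -- before a labelling is given.
  _^⊗ : Mat₂ → ∀ {n} → Subset n → Subset n → Carrier
  (X ^⊗) []      []      = 1#
  (X ^⊗) (s ∷ S) (t ∷ T) = X s t * (X ^⊗) S T

  ^⊗-cong : ∀ {X Y} → (∀ s t → X s t ≈ Y s t) → ∀ {n} (S T : Subset n) → (X ^⊗) S T ≈ (Y ^⊗) S T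
  ^⊗-cong X≈Y []      []      = refl
  ^⊗-cong X≈Y (s ∷ S) (t ∷ T) = *-cong (X≈Y s t) (^⊗-cong X≈Y S T)

  ^⊗-transpose : ∀ X {n} (S T : Subset n) → (flip X ^⊗) S T ≈ (X ^⊗) T S
  ^⊗-transpose X []      []      = refl
  ^⊗-transpose X (s ∷ S) (t ∷ T) = *-congˡ (^⊗-transpose X S T)

  ^⊗-diagonal : ∀ {X} → (∀ s → X s s ≈ 1#) → ∀ {n} (S : Subset n) → (X ^⊗) S S ≈ 1#
  ^⊗-diagonal X≈1 []      = refl
  ^⊗-diagonal X≈1 (s ∷ S) = trans (*-cong (X≈1 s) (^⊗-diagonal X≈1 S)) (*-identityˡ 1#)

  -- Some element lies in `S` but not in `T`, and its coordinate contributes the factor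
  -- `X inside outside`.
  ^⊗-upper : ∀ {X} → X inside outside ≈ 0# → ∀ {n} (S T : Subset n) → S ⊈ T → (X ^⊗) S T ≈ 0#
  ^⊗-upper X≈0 []            []            S⊈T = contradiction (λ {x} → ⊆-refl {x = []} {x}) S⊈T
  ^⊗-upper X≈0 (inside  ∷ S) (outside ∷ T) S⊈T = trans (*-congʳ X≈0) (zeroˡ _)
  ^⊗-upper X≈0 (outside ∷ S) (t       ∷ T) S⊈T = trans (*-congˡ (^⊗-upper X≈0 S T (λ S⊆T → S⊈T (out⊆ S⊆T)))) (zeroʳ _)
  ^⊗-upper X≈0 (inside  ∷ S) (inside  ∷ T) S⊈T = trans (*-congˡ (^⊗-upper X≈0 S T (λ S⊆T → S⊈T (in⊆in S⊆T)))) (zeroʳ _)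

  ∑ˢ-distribˡ : ∀ n a (f : Subset n → Carrier) → ∑ˢ n (λ S → a * f S) ≈ a * ∑ˢ n f
  ∑ˢ-distribˡ zero    a f = refl
  ∑ˢ-distribˡ (suc n) a f = trans (+-cong (∑ˢ-distribˡ n a _) (∑ˢ-distribˡ n a _)) (sym (distribˡ a _ _))

  -- The mixed-product property of Kronecker products: the sum is split by whether the first element
  -- belongs to `U`, and the entries for that element come out as a common factor.
  ^⊗-· : ∀ X Y {n} (S T : Subset n) → ∑ˢ n (λ U → (X ^⊗) S U * (Y ^⊗) U T) ≈ ((X · Y) ^⊗) S T
  ^⊗-· X Y             []      []      = *-identityˡ 1#
  ^⊗-· X Y {n = suc n} (s ∷ S) (t ∷ T) = trans
    (+-cong (slice outside) (slice inside))
    (sym (distribʳ _ _ _))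
    where
    slice : ∀ u → ∑ˢ n (λ U → X s u * (X ^⊗) S U * (Y u t * (Y ^⊗) U T)) ≈ X s u * Y u t * ((X · Y) ^⊗) S T
    slice u = begin
      ∑ˢ n (λ U → X s u * (X ^⊗) S U * (Y u t * (Y ^⊗) U T))
        ≈⟨ ∑ˢ-cong n (λ U → rearranged (X s u) _ (Y u t) _) ⟩
      ∑ˢ n (λ U → X s u * Y u t * ((X ^⊗) S U * (Y ^⊗) U T))
        ≈⟨ ∑ˢ-distribˡ n (X s u * Y u t) _ ⟩
      X s u * Y u t * ∑ˢ n (λ U → (X ^⊗) S U * (Y ^⊗) U T)
        ≈⟨ *-congˡ (^⊗-· X Y S T) ⟩
      X s u * Y u t * ((X · Y) ^⊗) S T ∎
      where
      rearranged : ∀ a b c d → a * b * (c * d) ≈ a * c * (b * d)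
      rearranged = solve 4 (λ a b c d → a :* b :* (c :* d) := a :* c :* (b :* d)) refl

  -- Determinants of matrices indexed through a labelling

  module _ {n} (L : Labelling (booleanAlgebra n) (2 ℕ.^ n)) where
    open Labelling L

    labelled : (Subset n → Subset n → Carrier) → Mat (2 ℕ.^ n) (2 ℕ.^ n)
    labelled F i j = F (label i) (label j)

    labelled-⊡ : ∀ F G → labelled F ⊡ labelled G ≋ labelled (λ S T → ∑ˢ n (λ U → F S U * G U T))
    labelled-⊡ F G i j = sum-label n L (λ U → F (label i) U * G U (label j))

    det-labelledUpper : ∀ F → (∀ S T → S ⊈ T → F S T ≈ 0#) → detᴿ (labelled F) ≈ ∏ˢ n (λ S → F S S)
    det-labelledUpper F upper = trans
      (det-upperTriangular (labelled F) λ i j j<i → upper (label i) (label j) (label-linear L j<i))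
      (product-label n L (λ S → F S S))

    det-labelledLower : ∀ F → (∀ S T → T ⊈ S → F S T ≈ 0#) → detᴿ (labelled F) ≈ ∏ˢ n (λ S → F S S)
    det-labelledLower F lower = trans (sym (det-transpose (labelled F)))
      (det-labelledUpper (flip F) (flip lower))

    det-unitriangular : ∀ X → X outside inside ≈ 0# → (∀ s → X s s ≈ 1#) → detᴿ (labelled (X ^⊗)) ≈ 1#
    det-unitriangular X X≈0 X≈1 = trans
      (det-labelledLower (X ^⊗) λ S T T⊈S →
        trans (sym (^⊗-transpose X T S)) (^⊗-upper X≈0 T S T⊈S))
      (trans (∏ˢ-cong n (^⊗-diagonal X≈1)) (∏ˢ-one n))
      where
      ∏ˢ-one : ∀ n → ∏ˢ n (λ _ → 1#) ≈ 1#
      ∏ˢ-one zero    = refl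
      ∏ˢ-one (suc n) = trans (*-cong (∏ˢ-one n) (∏ˢ-one n)) (*-identityˡ 1#)

    -- Tensor powers are not additive, so `X` and `Y` cannot be merged beforehand. Multiplication by
    -- `P ^⊗` and `Q ^⊗` acts on the two summands separately, and both multipliers have determinant
    -- one.
    det-sandwich : ∀ P Q X Y →
      P outside inside ≈ 0# → (∀ s → P s s ≈ 1#) →
      Q outside inside ≈ 0# → (∀ s → Q s s ≈ 1#) →
      detᴿ (labelled (λ S T → (X ^⊗) S T + (Y ^⊗) S T)) ≈
      detᴿ (labelled (λ S T → ((P · X · Q) ^⊗) S T + ((P · Y · Q) ^⊗) S T))
    det-sandwich P Q X Y P≈0 P≈1 Q≈0 Q≈1 = begin
      detᴿ (labelled X+Y)
        ≈⟨ *-identityˡ _ ⟨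
      1# * detᴿ (labelled X+Y)
        ≈⟨ *-identityʳ _ ⟨
      1# * detᴿ (labelled X+Y) * 1#
        ≈⟨ *-cong (*-congʳ (det-unitriangular P P≈0 P≈1)) (det-unitriangular Q Q≈0 Q≈1) ⟨
      detᴿ (labelled (P ^⊗)) * detᴿ (labelled X+Y) * detᴿ (labelled (Q ^⊗))
        ≈⟨ *-congʳ (det-⊡ (labelled (P ^⊗)) (labelled X+Y)) ⟨
      detᴿ (labelled (P ^⊗) ⊡ labelled X+Y) * detᴿ (labelled (Q ^⊗))
        ≈⟨ *-congʳ (det-cong λ i j → trans (labelled-⊡ (P ^⊗) X+Y i j) (left (label i) (label j))) ⟩
      detᴿ (labelled PX+PY) * detᴿ (labelled (Q ^⊗))
        ≈⟨ det-⊡ (labelled PX+PY) (labelled (Q ^⊗)) ⟨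
      detᴿ (labelled PX+PY ⊡ labelled (Q ^⊗))
        ≈⟨ det-cong (λ i j → trans (labelled-⊡ PX+PY (Q ^⊗) i j) (right (label i) (label j))) ⟩
      detᴿ (labelled (λ S T → ((P · X · Q) ^⊗) S T + ((P · Y · Q) ^⊗) S T)) ∎
      where
      X+Y PX+PY : Subset n → Subset n → Carrier
      X+Y   S T = (X ^⊗) S T + (Y ^⊗) S T
      PX+PY S T = ((P · X) ^⊗) S T + ((P · Y) ^⊗) S T

      left : ∀ S T → ∑ˢ n (λ U → (P ^⊗) S U * X+Y U T) ≈ PX+PY S T
      left S T = begin
        ∑ˢ n (λ U → (P ^⊗) S U * X+Y U T)
          ≈⟨ ∑ˢ-cong n (λ U → distribˡ _ _ _) ⟩
        ∑ˢ n (λ U → (P ^⊗) S U * (X ^⊗) U T + (P ^⊗) S U * (Y ^⊗) U T)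
          ≈⟨ ∑ˢ-+ n _ _ ⟩
        ∑ˢ n (λ U → (P ^⊗) S U * (X ^⊗) U T) + ∑ˢ n (λ U → (P ^⊗) S U * (Y ^⊗) U T)
          ≈⟨ +-cong (^⊗-· P X S T) (^⊗-· P Y S T) ⟩
        PX+PY S T ∎

      right : ∀ S T → ∑ˢ n (λ U → PX+PY S U * (Q ^⊗) U T) ≈ ((P · X · Q) ^⊗) S T + ((P · Y · Q) ^⊗) S T
      right S T = begin
        ∑ˢ n (λ U → PX+PY S U * (Q ^⊗) U T)
          ≈⟨ ∑ˢ-cong n (λ U → distribʳ _ _ _) ⟩
        ∑ˢ n (λ U → ((P · X) ^⊗) S U * (Q ^⊗) U T + ((P · Y) ^⊗) S U * (Q ^⊗) U T)
          ≈⟨ ∑ˢ-+ n _ _ ⟩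
        ∑ˢ n (λ U → ((P · X) ^⊗) S U * (Q ^⊗) U T) + ∑ˢ n (λ U → ((P · Y) ^⊗) S U * (Q ^⊗) U T)
          ≈⟨ +-cong (^⊗-· (P · X) Q S T) (^⊗-· (P · Y) Q S T) ⟩
        ((P · X · Q) ^⊗) S T + ((P · Y · Q) ^⊗) S T ∎

-- The Eisenstein integers

-- a +ζ b is a + bζ with ζ² + ζ + 1 = 0.  For a record, η would unfold every product of
-- unknown Eisenstein integers and make conversion checking infeasible.
data Eisenstein : Set where
  _+ζ_ : ℤ → ℤ → Eisenstein

-- Left inverse of `ι`, which brings the final equalities back to the integers.
re : Eisenstein → ℤ
re (a +ζ b) = a

infix 4 _+ζ_
infixl 6 _+ᴱ_
infixl 7 _*ᴱ_

_+ᴱ_ _*ᴱ_ : Eisenstein → Eisenstein → Eisenstein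
(a +ζ b) +ᴱ (c +ζ d) = a ℤ.+ c +ζ b ℤ.+ d
(a +ζ b) *ᴱ (c +ζ d) = a ℤ.* c ℤ.- b ℤ.* d +ζ a ℤ.* d ℤ.+ b ℤ.* c ℤ.- b ℤ.* d

eisenstein : CommutativeRing 0ℓ 0ℓ
eisenstein = record
  { Carrier = Eisenstein
  ; _≈_ = _≡_
  ; _+_ = _+ᴱ_
  ; _*_ = _*ᴱ_
  ; -_  = λ { (a +ζ b) → ℤ.- a +ζ ℤ.- b }
  ; 0#  = 0ℤ +ζ 0ℤ
  ; 1#  = 1ℤ +ζ 0ℤ
  ; isCommutativeRing = record
    { isRing = record
      { +-isAbelianGroup = record
        { isGroup = record
          { isMonoid = record
            { isSemigroup = record
              { isMagma = record { isEquivalence = ≡.isEquivalence ; ∙-cong = ≡.cong₂ _+ᴱ_ }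
              ; assoc = λ { (a +ζ b) (c +ζ d) (e +ζ f) → ≡.cong₂ _+ζ_ (ℤ.+-assoc a c e) (ℤ.+-assoc b d f) }
              }
            ; identity = (λ { (a +ζ b) → ≡.cong₂ _+ζ_ (ℤ.+-identityˡ a) (ℤ.+-identityˡ b) })
                       , (λ { (a +ζ b) → ≡.cong₂ _+ζ_ (ℤ.+-identityʳ a) (ℤ.+-identityʳ b) })
            }
          ; inverse = (λ { (a +ζ b) → ≡.cong₂ _+ζ_ (ℤ.+-inverseˡ a) (ℤ.+-inverseˡ b) })
                    , (λ { (a +ζ b) → ≡.cong₂ _+ζ_ (ℤ.+-inverseʳ a) (ℤ.+-inverseʳ b) })
          ; ⁻¹-cong = ≡.cong _
          }
        ; comm = λ { (a +ζ b) (c +ζ d) → ≡.cong₂ _+ζ_ (ℤ.+-comm a c) (ℤ.+-comm b d) }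
        }
      ; *-cong = ≡.cong₂ _*ᴱ_
      ; *-assoc = λ { (a +ζ b) (c +ζ d) (e +ζ f) → ≡.cong₂ _+ζ_ (assoc-re a b c d e f) (assoc-ζ a b c d e f) }
      ; *-identity = (λ { (a +ζ b) → ≡.cong₂ _+ζ_ (identityˡ-re a b) (identityˡ-ζ a b) })
                   , (λ { (a +ζ b) → ≡.cong₂ _+ζ_ (identityʳ-re a b) (identityʳ-ζ a b) })
      ; distrib = (λ { (a +ζ b) (c +ζ d) (e +ζ f) → ≡.cong₂ _+ζ_ (distribˡ-re a b c d e f) (distribˡ-ζ a b c d e f) })
                , (λ { (a +ζ b) (c +ζ d) (e +ζ f) → ≡.cong₂ _+ζ_ (distribʳ-re a b c d e f) (distribʳ-ζ a b c d e f) })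
      }
    ; *-comm = λ { (a +ζ b) (c +ζ d) → ≡.cong₂ _+ζ_ (comm-re a b c d) (comm-ζ a b c d) }
    }
  }
  where
  open import Data.Integer.Base using (_+_; _*_; _-_)

  assoc-re : ∀ a b c d e f → (a * c - b * d) * e - (a * d + b * c - b * d) * f ≡
                             a * (c * e - d * f) - b * (c * f + d * e - d * f)
  assoc-re = ℤ-Solver.solve-∀

  assoc-ζ : ∀ a b c d e f → (a * c - b * d) * f + (a * d + b * c - b * d) * e - (a * d + b * c - b * d) * f ≡
                            a * (c * f + d * e - d * f) + b * (c * e - d * f) - b * (c * f + d * e - d * f)
  assoc-ζ = ℤ-Solver.solve-∀

  identityˡ-re : ∀ a b → 1ℤ * a - 0ℤ * b ≡ a
  identityˡ-re = ℤ-Solver.solve-∀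

  identityˡ-ζ : ∀ a b → 1ℤ * b + 0ℤ * a - 0ℤ * b ≡ b
  identityˡ-ζ = ℤ-Solver.solve-∀

  identityʳ-re : ∀ a b → a * 1ℤ - b * 0ℤ ≡ a
  identityʳ-re = ℤ-Solver.solve-∀

  identityʳ-ζ : ∀ a b → a * 0ℤ + b * 1ℤ - b * 0ℤ ≡ b
  identityʳ-ζ = ℤ-Solver.solve-∀

  distribˡ-re : ∀ a b c d e f → a * (c + e) - b * (d + f) ≡ (a * c - b * d) + (a * e - b * f)
  distribˡ-re = ℤ-Solver.solve-∀

  distribˡ-ζ : ∀ a b c d e f → a * (d + f) + b * (c + e) - b * (d + f) ≡
                               (a * d + b * c - b * d) + (a * f + b * e - b * f)
  distribˡ-ζ = ℤ-Solver.solve-∀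

  distribʳ-re : ∀ a b c d e f → (c + e) * a - (d + f) * b ≡ (c * a - d * b) + (e * a - f * b)
  distribʳ-re = ℤ-Solver.solve-∀

  distribʳ-ζ : ∀ a b c d e f → (c + e) * b + (d + f) * a - (d + f) * b ≡
                               (c * b + d * a - d * b) + (e * b + f * a - f * b)
  distribʳ-ζ = ℤ-Solver.solve-∀

  comm-re : ∀ a b c d → a * c - b * d ≡ c * a - d * b
  comm-re = ℤ-Solver.solve-∀

  comm-ζ : ∀ a b c d → a * d + b * c - b * d ≡ c * b + d * a - d * b
  comm-ζ = ℤ-Solver.solve-∀

open CommutativeRing eisenstein
  using (_+_; _*_; -_; 0#; 1#; semiring; commutativeSemiring; *-identityˡ; zeroˡ; zeroʳ; *-assoc)
open Determinant eisenstein using (det-cong; ∑-cong) renaming (detᴿ to detᴱ)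
open TensorPower eisenstein
open import Algebra.Properties.Semiring.Exp semiring using (^-homo-*) renaming (_^_ to _^ᴱ_)
open import Algebra.Properties.Semiring.Sum semiring using (sum)
open import Algebra.Solver.Ring.NaturalCoefficients.Default commutativeSemiring
  using (solve; _:*_; _:=_)

-- Transfer of determinants from the integers

ι : ℤ → Eisenstein
ι a = a +ζ 0ℤ

ι-* : ∀ a b → ι (a ℤ.* b) ≡ ι a * ι b
ι-* a b = ≡.cong₂ _+ζ_ (re-part a b) (ζ-part a b)
  where
  re-part : ∀ a b → a ℤ.* b ≡ a ℤ.* b ℤ.- 0ℤ ℤ.* 0ℤ
  re-part = ℤ-Solver.solve-∀

  ζ-part : ∀ a b → 0ℤ ≡ a ℤ.* 0ℤ ℤ.+ 0ℤ ℤ.* b ℤ.- 0ℤ ℤ.* 0ℤ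
  ζ-part = ℤ-Solver.solve-∀

ι-sum : ∀ {n} (t : Fin n → ℤ) → ι (ℤ-Sum.sum t) ≡ sum (ι ∘ t)
ι-sum {zero}  t = ≡.refl
ι-sum {suc n} t = ≡.cong (λ x → ι (t zero) + x) (ι-sum (t ∘ suc))

ι-sign : ∀ k → ι (-1ℤ ℤ.^ k) ≡ (- 1#) ^ᴱ k
ι-sign zero    = ≡.refl
ι-sign (suc k) = ≡.trans (ι-* -1ℤ (-1ℤ ℤ.^ k)) (≡.cong (- 1# *_) (ι-sign k))

-- `ι` respects sums, products and signs, and both determinants are the same Laplace expansion.
ι-det : ∀ {n} (M : Matrix n n) → ι (det M) ≡ detᴱ (λ i j → ι (M i j))
ι-det {zero}  M = ≡.refl
ι-det {suc n} M = ≡.trans (ι-sum term) (∑-cong (ι ∘ term) termᴱ λ j → ≡.trans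
  (ι-* (-1ℤ ℤ.^ toℕ j ℤ.* M zero j) (det (minor j)))
  (≡.cong₂ _*_
    (≡.trans (ι-* (-1ℤ ℤ.^ toℕ j) (M zero j)) (≡.cong (_* ι (M zero j)) (ι-sign (toℕ j))))
    (ι-det (minor j))))
  where
  minor : Fin (suc n) → Matrix n n
  minor j i k = M (suc i) (punchIn j k)

  term : Fin (suc n) → ℤ
  term j = -1ℤ ℤ.^ toℕ j ℤ.* M zero j ℤ.* det (minor j)

  termᴱ : Fin (suc n) → Eisenstein
  termᴱ j = (- 1#) ^ᴱ toℕ j * ι (M zero j) * detᴱ (λ i k → ι (minor j i k))

two : Eisenstein
two = ι (+ 2)

ι-2^ : ∀ k → ι (+ (2 ^ k)) ≡ two ^ᴱ k
ι-2^ zero    = ≡.refl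
ι-2^ (suc k) = ≡.trans (≡.cong ι (ℤ.pos-* 2 (2 ^ k))) (≡.trans (ι-* (+ 2) (+ (2 ^ k))) (≡.cong (two *_) (ι-2^ k)))

-- Simultaneous triangularisation of the chain matrix and its transpose

ζ ζ² : Eisenstein
ζ  = 0ℤ +ζ 1ℤ
ζ² = ζ * ζ

chain : Mat₂
chain inside outside = 0#
chain _      _       = 1#

-- The first column of Q is an eigenvector of chain⁻ᵀ · chain, and P = Q⁻¹ · chain⁻ᵀ.
P Q C I₂ : Mat₂
P outside inside  = 0#
P inside  outside = ζ²
P _       _       = 1#

Q outside inside  = 0#
Q inside  outside = ζ
Q _       _       = 1#

C outside outside = - ζ²
C outside inside  = 1#
C inside  outside = 0#
C inside  inside  = - ζ

I₂ outside outside = 1#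
I₂ inside  inside  = 1#
I₂ _       _       = 0#

P·chain·Q : ∀ s t → (P · chain · Q) s t ≡ C s t
P·chain·Q outside outside = ≡.refl
P·chain·Q outside inside  = ≡.refl
P·chain·Q inside  outside = ≡.refl
P·chain·Q inside  inside  = ≡.refl

P·chainᵀ·Q : ∀ s t → (P · flip chain · Q) s t ≡ I₂ s t
P·chainᵀ·Q outside outside = ≡.refl
P·chainᵀ·Q outside inside  = ≡.refl
P·chainᵀ·Q inside  outside = ≡.refl
P·chainᵀ·Q inside  inside  = ≡.refl

P-diagonal : ∀ s → P s s ≡ 1#
P-diagonal outside = ≡.refl
P-diagonal inside  = ≡.refl

Q-diagonal : ∀ s → Q s s ≡ 1#
Q-diagonal outside = ≡.refl
Q-diagonal inside  = ≡.refl

I₂-diagonal : ∀ s → I₂ s s ≡ 1#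
I₂-diagonal outside = ≡.refl
I₂-diagonal inside  = ≡.refl

-- `_⊆?_` recurses through the coordinates as `chain ^⊗` does: only `inside` against `outside`
-- refuses at once, and there the factor of `chain` is zero.
zeta-chain : ∀ {n} (S T : Subset n) → ι (if does (S ⊆? T) then 1ℤ else 0ℤ) ≡ (chain ^⊗) S T
zeta-chain []            []            = ≡.refl
zeta-chain (outside ∷ S) (t       ∷ T) = ≡.trans (zeta-chain S T) (≡.sym (*-identityˡ _))
zeta-chain (inside  ∷ S) (outside ∷ T) = ≡.sym (zeroˡ ((chain ^⊗) S T))
zeta-chain (inside  ∷ S) (inside  ∷ T) = ≡.trans (zeta-chain S T) (≡.sym (*-identityˡ _))

-- Products over the diagonal of the triangular form

-- The parameter `a` absorbs the diagonal entry of `C` at a removed element, which makes a recursion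
-- in `n` possible; the determinant sought is the value at `1#`.
shiftedProduct : ℕ → Eisenstein → Eisenstein
shiftedProduct n a = ∏ˢ n (λ S → a * (C ^⊗) S S + 1#)

det-ℨ : ∀ n L → ι (det (ℨ n L)) ≡ shiftedProduct n 1#
det-ℨ n L = begin
  ι (det (ℨ n L))
    ≡⟨ ι-det (ℨ n L) ⟩
  detᴱ (λ i j → ι (ℨ n L i j))
    ≡⟨ det-cong (λ i j → ≡.cong₂ _+_ (zeta-chain (label i) (label j))
         (≡.trans (zeta-chain (label j) (label i)) (≡.sym (^⊗-transpose chain (label i) (label j))))) ⟩
  detᴱ (labelled L (λ S T → (chain ^⊗) S T + (flip chain ^⊗) S T))
    ≡⟨ det-sandwich L P Q chain (flip chain) ≡.refl P-diagonal ≡.refl Q-diagonal ⟩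
  detᴱ (labelled L (λ S T → ((P · chain · Q) ^⊗) S T + ((P · flip chain · Q) ^⊗) S T))
    ≡⟨ det-cong (λ i j → ≡.cong₂ _+_ (^⊗-cong P·chain·Q (label i) (label j)) (^⊗-cong P·chainᵀ·Q (label i) (label j))) ⟩
  detᴱ (labelled L (λ S T → (C ^⊗) S T + (I₂ ^⊗) S T))
    ≡⟨ det-labelledUpper L _ (λ S T S⊈T → ≡.cong₂ _+_ (^⊗-upper {C} ≡.refl S T S⊈T) (^⊗-upper {I₂} ≡.refl S T S⊈T)) ⟩
  ∏ˢ n (λ S → (C ^⊗) S S + (I₂ ^⊗) S S)
    ≡⟨ ∏ˢ-cong n (λ S → ≡.cong₂ _+_ (≡.sym (*-identityˡ ((C ^⊗) S S))) (^⊗-diagonal {I₂} I₂-diagonal S)) ⟩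
  shiftedProduct n 1# ∎
  where
  open Labelling L
  open ≡.≡-Reasoning

shiftedProduct-suc : ∀ n a → shiftedProduct (suc n) a ≡ shiftedProduct n (a * - ζ²) * shiftedProduct n (a * - ζ)
shiftedProduct-suc n a = ≡.cong₂ _*_
  (∏ˢ-cong n λ S → ≡.cong (_+ 1#) (≡.sym (*-assoc a (- ζ²) ((C ^⊗) S S))))
  (∏ˢ-cong n λ S → ≡.cong (_+ 1#) (≡.sym (*-assoc a (- ζ) ((C ^⊗) S S))))

-- Two elements go at once so that `a` stays among the cube roots of unity: `(- ζ²)² = ζ`,
-- `(- ζ²) (- ζ) = 1` and `(- ζ)² = ζ²`. For `a` equal to `1#`, `ζ` or `ζ²` the four new parameters
-- are closed terms and evaluate by computation.
shiftedProduct-suc-suc : ∀ n a → shiftedProduct (2 ℕ.+ n) a ≡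
  shiftedProduct n (a * - ζ² * - ζ²) * shiftedProduct n (a * - ζ² * - ζ) *
  (shiftedProduct n (a * - ζ * - ζ²) * shiftedProduct n (a * - ζ * - ζ))
shiftedProduct-suc-suc n a = ≡.trans (shiftedProduct-suc (suc n) a)
  (≡.cong₂ _*_ (shiftedProduct-suc n (a * - ζ²)) (shiftedProduct-suc n (a * - ζ)))

-- Splitting off two elements at `ζ` reproduces a factor at `ζ`, so the zero at rank one persists.
shiftedProduct-odd : ∀ k → shiftedProduct (1 ℕ.+ k ℕ.* 2) ζ ≡ 0#
-- The empty set contributes the factor `1 + ζ (- ζ²) = 1 - ζ³ = 0`.
shiftedProduct-odd zero    = ≡.refl
shiftedProduct-odd (suc k) = begin
  shiftedProduct (2 ℕ.+ n) ζ  ≡⟨ shiftedProduct-suc-suc n ζ ⟩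
  z * y * (y * x)             ≡⟨ ≡.cong (λ p → z * p * (y * x)) (shiftedProduct-odd k) ⟩
  z * 0# * (y * x)            ≡⟨ ≡.cong (_* (y * x)) (zeroʳ z) ⟩
  0# * (y * x)                ≡⟨ zeroˡ (y * x) ⟩
  0#                          ∎
  where
  open ≡.≡-Reasoning
  n = 1 ℕ.+ k ℕ.* 2
  x = shiftedProduct n 1#
  y = shiftedProduct n ζ
  z = shiftedProduct n ζ²

-- Write `x`, `y`, `z` for the values at `1#`, `ζ`, `ζ²`. The recursion sends `x` to `x² (yz)` and
-- `yz` to `x² (yz)³`, so this pair is closed under it. The product `yz` is tracked because `y` and
-- `z` need not be integers: at rank two they are `- 2 ζ²` and `- 2 ζ`.
shiftedProduct-even : ∀ k → let n = 2 ℕ.+ k ℕ.* 2 in ∃[ a ]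
  α n ≡ suc a ×
  shiftedProduct n 1# ≡ two ^ᴱ suc a ×
  shiftedProduct n ζ * shiftedProduct n ζ² ≡ two ^ᴱ (a ℕ.+ a)
shiftedProduct-even zero    = 1 , ≡.refl , ≡.refl , ≡.refl
shiftedProduct-even (suc k) with a , αn≡1+a , x≡ , yz≡ ← shiftedProduct-even k =
  -- With `a = α n - 1`, the recursion gives `α (2 + n) - 1 = 4 (a + 1) - 3 = 4 a + 1`.
  suc (4 ℕ.* a) , α-step , x-step , yz-step
  where
  open ≡.≡-Reasoning
  n = 2 ℕ.+ k ℕ.* 2
  x = shiftedProduct n 1#
  y = shiftedProduct n ζ
  z = shiftedProduct n ζ²

  α-step : α (2 ℕ.+ n) ≡ suc (suc (4 ℕ.* a))
  α-step = begin
    4 ℕ.* α n ℕ.∸ 2      ≡⟨ ≡.cong (λ m → 4 ℕ.* m ℕ.∸ 2) αn≡1+a ⟩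
    4 ℕ.* suc a ℕ.∸ 2    ≡⟨ ≡.cong (ℕ._∸ 2) (ℕ.*-suc 4 a) ⟩
    suc (suc (4 ℕ.* a))  ∎

  xx≡ : x * x ≡ two ^ᴱ (suc a ℕ.+ suc a)
  xx≡ = ≡.trans (≡.cong₂ _*_ x≡ x≡) (≡.sym (^-homo-* two (suc a) (suc a)))

  x-step : shiftedProduct (2 ℕ.+ n) 1# ≡ two ^ᴱ suc (suc (4 ℕ.* a))
  x-step = begin
    shiftedProduct (2 ℕ.+ n) 1#
      ≡⟨ shiftedProduct-suc-suc n 1# ⟩
    y * x * (x * z)
      ≡⟨ solve 3 (λ x y z → y :* x :* (x :* z) := (x :* x) :* (y :* z)) ≡.refl x y z ⟩
    (x * x) * (y * z)
      ≡⟨ ≡.cong₂ _*_ xx≡ yz≡ ⟩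
    two ^ᴱ (suc a ℕ.+ suc a) * two ^ᴱ (a ℕ.+ a)
      ≡⟨ ^-homo-* two (suc a ℕ.+ suc a) (a ℕ.+ a) ⟨
    two ^ᴱ (suc a ℕ.+ suc a ℕ.+ (a ℕ.+ a))
      ≡⟨ ≡.cong (two ^ᴱ_) (exponent a) ⟩
    two ^ᴱ suc (suc (4 ℕ.* a)) ∎
    where
    exponent : ∀ a → suc a ℕ.+ suc a ℕ.+ (a ℕ.+ a) ≡ suc (suc (4 ℕ.* a))
    exponent = ℕ-Solver.solve-∀

  yz-step : shiftedProduct (2 ℕ.+ n) ζ * shiftedProduct (2 ℕ.+ n) ζ² ≡ two ^ᴱ (suc (4 ℕ.* a) ℕ.+ suc (4 ℕ.* a))
  yz-step = begin
    shiftedProduct (2 ℕ.+ n) ζ * shiftedProduct (2 ℕ.+ n) ζ²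
      ≡⟨ ≡.cong₂ _*_ (shiftedProduct-suc-suc n ζ) (shiftedProduct-suc-suc n ζ²) ⟩
    z * y * (y * x) * (x * z * (z * y))
      ≡⟨ solve 3 (λ x y z → z :* y :* (y :* x) :* (x :* z :* (z :* y)) :=
                            (x :* x) :* ((y :* z) :* ((y :* z) :* (y :* z)))) ≡.refl x y z ⟩
    (x * x) * ((y * z) * ((y * z) * (y * z)))
      ≡⟨ ≡.cong₂ _*_ xx≡ (≡.cong (λ p → p * (p * p)) yz≡) ⟩
    two ^ᴱ (suc a ℕ.+ suc a) * (two ^ᴱ (a ℕ.+ a) * (two ^ᴱ (a ℕ.+ a) * two ^ᴱ (a ℕ.+ a)))
      ≡⟨ ≡.cong (λ p → two ^ᴱ (suc a ℕ.+ suc a) * (two ^ᴱ (a ℕ.+ a) * p)) (^-homo-* two (a ℕ.+ a) (a ℕ.+ a)) ⟨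
    two ^ᴱ (suc a ℕ.+ suc a) * (two ^ᴱ (a ℕ.+ a) * two ^ᴱ (a ℕ.+ a ℕ.+ (a ℕ.+ a)))
      ≡⟨ ≡.cong (two ^ᴱ (suc a ℕ.+ suc a) *_) (^-homo-* two (a ℕ.+ a) (a ℕ.+ a ℕ.+ (a ℕ.+ a))) ⟨
    two ^ᴱ (suc a ℕ.+ suc a) * two ^ᴱ (a ℕ.+ a ℕ.+ (a ℕ.+ a ℕ.+ (a ℕ.+ a)))
      ≡⟨ ^-homo-* two (suc a ℕ.+ suc a) (a ℕ.+ a ℕ.+ (a ℕ.+ a ℕ.+ (a ℕ.+ a))) ⟨
    two ^ᴱ (suc a ℕ.+ suc a ℕ.+ (a ℕ.+ a ℕ.+ (a ℕ.+ a ℕ.+ (a ℕ.+ a))))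
      ≡⟨ ≡.cong (two ^ᴱ_) (exponent a) ⟩
    two ^ᴱ (suc (4 ℕ.* a) ℕ.+ suc (4 ℕ.* a)) ∎
    where
    exponent : ∀ a → suc a ℕ.+ suc a ℕ.+ (a ℕ.+ a ℕ.+ (a ℕ.+ a ℕ.+ (a ℕ.+ a))) ≡ suc (4 ℕ.* a) ℕ.+ suc (4 ℕ.* a)
    exponent = ℕ-Solver.solve-∀

-- Odd and even rank

-- Removing two elements from rank `3 + k * 2` leaves the rank `1 + k * 2` treated by
-- `shiftedProduct-odd`.
odd-form : ∀ n → 3 ≤ n → 2 ∤ n → ∃[ k ] n ≡ 3 ℕ.+ k ℕ.* 2
odd-form n 3≤n 2∤n with n % 2 | n / 2 | m≡m%n+[m/n]*n n 2 | m%n<n n 2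
... | 0           | q     | n≡ | _               = contradiction (divides q n≡) 2∤n
... | 1           | 0     | n≡ | _               = contradiction (ℕ.≤-trans 3≤n (ℕ.≤-reflexive n≡)) λ { (s≤s ()) }
... | 1           | suc q | n≡ | _               = q , n≡
... | suc (suc _) | _     | _  | s≤s (s≤s ())

mainTheorem1 : (n : ℕ) .{{_ : NonZero n}} (L : Labelling (booleanAlgebra n) (2 ^ n)) →
    (3 ≤ n → 2 ∤ n → det (ℨ n L) ≡ 0ℤ) ×
    (2 ∣ n → det (ℨ n L) ≡ + (2 ^ α n))
mainTheorem1 n L = odd , even
  where
  odd : 3 ≤ n → 2 ∤ n → det (ℨ n L) ≡ 0ℤ
  odd 3≤n 2∤n with k , ≡.refl ← odd-form n 3≤n 2∤n = ≡.cong re (begin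
    ι (det (ℨ n L))      ≡⟨ det-ℨ n L ⟩
    -- One of the four factors at rank `m = n - 2` has parameter `ζ` and is therefore zero.
    shiftedProduct n 1#  ≡⟨ shiftedProduct-suc-suc m 1# ⟩
    y * x * (x * z)      ≡⟨ ≡.cong (λ p → p * x * (x * z)) (shiftedProduct-odd k) ⟩
    0# * x * (x * z)     ≡⟨ ≡.cong (_* (x * z)) (zeroˡ x) ⟩
    0# * (x * z)         ≡⟨ zeroˡ (x * z) ⟩
    0#                   ∎)
    where
    open ≡.≡-Reasoning
    m = 1 ℕ.+ k ℕ.* 2
    x = shiftedProduct m 1#
    y = shiftedProduct m ζ
    z = shiftedProduct m ζ²

  even : 2 ∣ n → det (ℨ n L) ≡ + (2 ^ α n)
  -- The quotient `0` would make `n` zero, against `NonZero n`; hence `n` is `2 + k * 2`.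
  even (divides (suc k) ≡.refl) with a , αn≡1+a , x≡ , _ ← shiftedProduct-even k = ≡.cong re (begin
    ι (det (ℨ n L))      ≡⟨ det-ℨ n L ⟩
    shiftedProduct n 1#  ≡⟨ x≡ ⟩
    two ^ᴱ suc a         ≡⟨ ≡.cong (two ^ᴱ_) αn≡1+a ⟨
    two ^ᴱ α n           ≡⟨ ι-2^ (α n) ⟨
    ι (+ (2 ^ α n))      ∎)
    where open ≡.≡-Reasoning
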